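{- Let $F$ be a forest. Then $\mathsf{TS}_2(F)$ is acyclic if and only if $F$ is $\{2K_2, D_{2,2,2}\}$-free.
   Context: Graphs are finite, simple and undirected. For a graph $G$ and an integer $k\ge 2$, $\mathsf{TS}_k(G)$ is the graph whose nodes are all size-$k$ independent sets of $G$, two nodes $I,J$ being adjacent if there are vertices $u,v$ of $G$ with $I\setminus J=\{u\}$, $J\setminus I=\{v\}$ and $uv\in E(G)$. (A graph with no nodes counts as acyclic.) $2K_2$ is the disjoint union of two copies of $K_2$. For integers $n,r,s\ge 1$, $D_{r,n,s}$ is the tree obtained from the path $P_n$ on $n$ vertices by attaching $r$ leaves to one end vertex and $s$ leaves to the other end vertex. A graph is $\mathcal{F}$-free if it contains no member of $\mathcal{F}$ as an induced subgraph (up to isomorphism). -}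

module Defs where

open import Data.Bool.Properties using () renaming (_≟_ to _≟ᵇ_)
open import Data.Fin using (Fin; zero; suc; toℕ; fromℕ; inject₁)
open import Data.Fin.Properties using (any?) renaming (_≟_ to _≟ᶠ_)
open import Data.Fin.Subset using (Subset; _∈_; _─_; ⁅_⁆; ∣_∣)
open import Data.Fin.Subset.Properties using (x∈⁅x⁆; x∈⁅y⁆⇒x≡y)
open import Data.List using (List)
open import Data.List.Relation.Unary.All using (All)
open import Data.Nat using (ℕ; _+_) renaming (suc to 1+_)
open import Data.Nat.Properties using () renaming (_≟_ to _≟ⁿ_)
open import Data.Product using (∃; ∃₂; _×_; _,_)
open import Data.Refinement using (Refinement-syntax; value)
open import Data.Sum using (_⊎_)
open import Data.Sum.Relation.Binary.Pointwise using (Pointwise; ⊎-symmetric; ⊎-decidable; inj₁; inj₂)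
open import Data.Vec.Properties using (≡-dec)
open import Function.Definitions using (Injective)
open import Relation.Binary.Construct.Closure.Symmetric using (SymClosure; fwd; bwd; symmetric)
open import Relation.Binary.Core using (Rel)
open import Relation.Binary.Definitions using (Symmetric; Decidable)
open import Relation.Binary.PropositionalEquality using (_≡_; _≢_; refl; sym; trans; subst; ≢-sym)
open import Relation.Nullary using (¬_; yes; no)
open import Relation.Nullary.Decidable using (map′; ¬?; _×-dec_; _⊎-dec_)
open import Level using (0ℓ)

-- A finite graph is, up to isomorphism, a `Graph (Fin n)`.
record Graph (V : Set) : Set₁ where
  field
    Adj        : Rel V 0ℓ
    adj-sym    : Symmetric Adj
    adj-irrefl : ∀ {v} → ¬ Adj v v
    adj?       : Decidable Adj

open Graph public

-- The vertices v₀, …, v_{m+2} are distinct, so the cycle has length 3 + m.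
record Cycle {V : Set} (G : Graph V) : Set where
  field
    m        : ℕ
    vertex   : Fin (3 + m) → V
    distinct : Injective _≡_ _≡_ vertex
    step     : ∀ (i : Fin (2 + m)) → Adj G (vertex (inject₁ i)) (vertex (suc i))
    close    : Adj G (vertex (fromℕ (2 + m))) (vertex zero)

Acyclic : {V : Set} → Graph V → Set
Acyclic G = ¬ Cycle G

Forest : ∀ {n} → Graph (Fin n) → Set
Forest F = Acyclic F

-- H is isomorphic to an induced subgraph of G.
record _⊑_ {W V : Set} (H : Graph W) (G : Graph V) : Set where
  field
    embed     : W → V
    injective : Injective _≡_ _≡_ embed
    preserves : ∀ {x y} → Adj H x y → Adj G (embed x) (embed y)
    reflects  : ∀ {x y} → Adj G (embed x) (embed y) → Adj H x y

Free : {V : Set} → List (∃ Graph) → Graph V → Set₁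
Free 𝓕 G = All (λ (_ , H) → ¬ (H ⊑ G)) 𝓕

Independent : ∀ {n} → Graph (Fin n) → Subset n → Set
Independent G S = ∀ {u v} → u ∈ S → v ∈ S → ¬ Adj G u v

-- The proof component of a refinement is irrelevant, so two nodes are
-- equal exactly when the underlying subsets are.
IndSet : ∀ {n} → ℕ → Graph (Fin n) → Set
IndSet {n} k G = [ S ∈ Subset n ∣ (∣ S ∣ ≡ k × Independent G S) ]

Slide : ∀ {n} → Graph (Fin n) → Rel (Subset n) 0ℓ
Slide G I J = ∃₂ λ u v → I ─ J ≡ ⁅ u ⁆ × J ─ I ≡ ⁅ v ⁆ × Adj G u v

TS : ∀ {n} (k : ℕ) (G : Graph (Fin n)) → Graph (IndSet k G)
TS k G = record
  { Adj        = λ I J → Slide G (value I) (value J)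
  ; adj-sym    = λ (u , v , p , q , e) → v , u , q , p , adj-sym G e
  ; adj-irrefl = λ (u , v , p , q , e) →
      adj-irrefl G (subst (Adj G u)
        (sym (x∈⁅y⁆⇒x≡y v (subst (u ∈_) (trans (sym p) q) (x∈⁅x⁆ u)))) e)
  ; adj?       = λ I J → any? λ u → any? λ v →
      ≡-dec _≟ᵇ_ (value I ─ value J) ⁅ u ⁆ ×-dec
      ≡-dec _≟ᵇ_ (value J ─ value I) ⁅ v ⁆ ×-dec
      adj? G u v
  }

K : (n : ℕ) → Graph (Fin n)
K n = record
  { Adj        = _≢_
  ; adj-sym    = ≢-sym
  ; adj-irrefl = λ v≢v → v≢v refl
  ; adj?       = λ x y → ¬? (x ≟ᶠ y)
  }

_⊎ᴳ_ : {V W : Set} → Graph V → Graph W → Graph (V ⊎ W)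
G ⊎ᴳ H = record
  { Adj        = Pointwise (Adj G) (Adj H)
  ; adj-sym    = ⊎-symmetric (adj-sym G) (adj-sym H)
  ; adj-irrefl = λ { (inj₁ e) → adj-irrefl G e ; (inj₂ e) → adj-irrefl H e }
  ; adj?       = ⊎-decidable (adj? G) (adj? H)
  }

2K₂ : Graph (Fin 2 ⊎ Fin 2)
2K₂ = K 2 ⊎ᴳ K 2

data DVertex (r n s : ℕ) : Set where
  path  : Fin n → DVertex r n s
  leafˡ : Fin r → DVertex r n s
  leafʳ : Fin s → DVertex r n s

-- Each edge once; the ends of the path are numbered 0 and n - 1.
data DEdge {r n s : ℕ} : Rel (DVertex r n s) 0ℓ where
  path  : ∀ {i j} → toℕ j ≡ 1+ toℕ i → DEdge (path i) (path j)
  leafˡ : ∀ {i a} → toℕ i ≡ 0 → DEdge (path i) (leafˡ a)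
  leafʳ : ∀ {i b} → 1+ toℕ i ≡ n → DEdge (path i) (leafʳ b)

dEdge? : ∀ {r n s} → Decidable (DEdge {r} {n} {s})
dEdge? (path i)  (path j)  = map′ path (λ { (path e) → e }) (toℕ j ≟ⁿ 1+ toℕ i)
dEdge? (path i)  (leafˡ a) = map′ leafˡ (λ { (leafˡ e) → e }) (toℕ i ≟ⁿ 0)
dEdge? {n = n} (path i) (leafʳ b) = map′ leafʳ (λ { (leafʳ e) → e }) (1+ toℕ i ≟ⁿ n)
dEdge? (leafˡ _) _         = no λ ()
dEdge? (leafʳ _) _         = no λ ()

dEdge-irrefl : ∀ {r n s} {x : DVertex r n s} → ¬ DEdge x x
dEdge-irrefl (path {i} e) = i≢1+i e
  where
  i≢1+i : ∀ {k} → k ≢ 1+ k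
  i≢1+i ()

-- Meaningful for r, n, s ≥ 1; for n = 1 both ends are the single path vertex.
D : (r n s : ℕ) → Graph (DVertex r n s)
D r n s = record
  { Adj        = SymClosure DEdge
  ; adj-sym    = symmetric DEdge
  ; adj-irrefl = λ { (fwd e) → dEdge-irrefl e ; (bwd e) → dEdge-irrefl e }
  ; adj?       = λ x y → map′
      (λ { (_⊎_.inj₁ e) → fwd e ; (_⊎_.inj₂ e) → bwd e })
      (λ { (fwd e) → _⊎_.inj₁ e ; (bwd e) → _⊎_.inj₂ e })
      (dEdge? x y ⊎-dec dEdge? y x)
  }

{-# OPTIONS --safe #-}
-- For a forest F, an induced 2K₂ or D₂,₂,₂ carries a cycle of length 4 resp. 8 in TS₂(F).
-- Conversely, follow the two tokens along a cycle of TS₂(F). If only one token ever moves,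
-- it traces a cycle of F. Otherwise the walk has a turn, where one token moves right after
-- the other. As F is 2K₂-free, the edges used by the two moves are joined by an edge at a
-- turn; this forces the next three moves, and the first five moves exhibit an induced D₂,₂,₂.

module Submission where

open import Defs
open import Data.Bool using (Bool; true; false)
open import Data.Bool.Properties using () renaming (_≟_ to _≟ᵇ_)
open import Data.Empty using (⊥; ⊥-elim-irr)
open import Data.Fin using (Fin; zero; suc; toℕ; fromℕ; inject₁; #_)
open import Data.Fin.Induction using (<-weakInduction)
open import Data.Fin.Properties using (all?; suc-injective; toℕ-fromℕ; toℕ-inject₁)
  renaming (_≟_ to _≟ᶠ_)
open import Data.Fin.Relation.Unary.Top using (view; ‵fromℕ; ‵inject₁; view-fromℕ; view-inject₁)
open import Data.Fin.Subset using (Subset; inside; outside; _∈_; _∉_; _─_; _∪_; ⁅_⁆; ∣_∣)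
  renaming (⊥ to ∅)
open import Data.Fin.Subset.Properties
  using (_∈?_; x∈⁅x⁆; x∈⁅y⁆⇒x≡y; ∣⁅x⁆∣≡1; ⊆-antisym; ∪-identityˡ; ∪-identityʳ; ∪-comm
        ; x∈p∪q⁻; x∈p∪q⁺; x∈p∧x∉q⇒x∈p─q; p─q⊆p)
open import Data.Irrelevant using ([_])
open import Data.List using ([]; _∷_)
import Data.List.Relation.Unary.All as List
open import Data.Nat using (ℕ; _+_)
import Data.Nat.Properties as ℕ
open import Data.Product using (∃; _×_; _,_; proj₁; proj₂)
open import Data.Refinement using (value; value-injective) renaming (_,_ to _⟦,⟧_)
open import Data.Sum using (_⊎_; inj₁; inj₂)
open import Data.Sum.Relation.Binary.Pointwise using (inj₁; inj₂)
open import Data.Vec using (Vec; []; _∷_; lookup; here; there)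
open import Data.Vec.Relation.Unary.All using ([]; _∷_)
open import Data.Vec.Relation.Unary.AllPairs using ([]; _∷_)
open import Data.Vec.Relation.Unary.Unique.Propositional using (Unique)
open import Data.Vec.Relation.Unary.Unique.Propositional.Properties using (lookup-injective)
open import Function.Base using (_∘_; case_of_)
open import Function.Bundles using (_⇔_; mk⇔)
open import Function.Definitions using (Injective)
open import Relation.Binary.Construct.Closure.Symmetric using (fwd; bwd)
open import Relation.Binary.PropositionalEquality
  using (_≡_; _≢_; refl; sym; trans; cong; cong₂; subst; subst₂; ≢-sym)
open import Relation.Nullary using (¬_; yes; no; contradiction)
open import Relation.Nullary.Decidable using (recompute; ¬?; from-yes)

private
  variable
    V W : Set
    n r s : ℕ

-- Cyclic successor of positions on a cycle.

next : Fin (1 + n) → Fin (1 + n)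
next i with view i
... | ‵fromℕ     = zero
... | ‵inject₁ j = suc j

next-fromℕ : next (fromℕ n) ≡ zero
next-fromℕ {n} rewrite view-fromℕ n = refl

next-inject₁ : (i : Fin n) → next (inject₁ i) ≡ suc i
next-inject₁ i rewrite view-inject₁ i = refl

toℕ-next : (i : Fin (1 + n)) → toℕ (next i) ≡ 1 + toℕ i ⊎ (toℕ i ≡ n × next i ≡ zero)
toℕ-next {n} i with view i
... | ‵fromℕ     = inj₂ (toℕ-fromℕ n , refl)
... | ‵inject₁ j = inj₁ (cong (1 +_) (sym (toℕ-inject₁ j)))

-- Two steps add 2, or cross the wrap-around and lead from `1 + n` to `0` or from `2 + n` to `1`.
-- Length at least 3 is what separates these pairs.
next²≢ : (i : Fin (3 + n)) → next (next i) ≢ i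
next²≢ i i₂≡i with toℕ-next i | toℕ-next (next i)
... | inj₁ p | inj₁ q =
  ℕ.m≢1+n+m (toℕ i) (trans (sym (cong toℕ i₂≡i)) (trans q (cong (1 +_) p)))
... | inj₁ p | inj₂ (q , r) with refl ← trans (sym i₂≡i) r = case trans (sym p) q of λ ()
... | inj₂ (p , r) | inj₁ q rewrite r = case trans (sym p) (trans (cong toℕ (sym i₂≡i)) q) of λ ()
... | inj₂ (p , r) | inj₂ (q , _) rewrite r = case q of λ ()

module _ {G : Graph V} where

  -- With `next` the closing edge becomes an ordinary step; `cycle` below is the converse passage.
  next-adj : (C : Cycle G) → ∀ i → Adj G (Cycle.vertex C i) (Cycle.vertex C (next i))
  next-adj C i with view i
  ... | ‵fromℕ     = Cycle.close C
  ... | ‵inject₁ j = Cycle.step C j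

  cycle : ∀ {m} (f : Fin (3 + m) → V) → Injective _≡_ _≡_ f →
          (∀ i → Adj G (f i) (f (next i))) → Cycle G
  cycle {m} f inj adj = record
    { m        = m
    ; vertex   = f
    ; distinct = inj
    ; step     = λ i → subst (λ j → Adj G (f (inject₁ i)) (f j)) (next-inject₁ i) (adj (inject₁ i))
    ; close    = subst (λ j → Adj G (f (fromℕ (2 + m))) (f j)) next-fromℕ (adj (fromℕ (2 + m)))
    }

  adj⇒≢ : ∀ {x y} → Adj G x y → x ≢ y
  adj⇒≢ e refl = adj-irrefl G e

-- Short cycles in a forest

module _ {G : Graph V} (acyclic : Acyclic G) where

  private
    vec-cycle : ∀ {m} (xs : Vec V (3 + m)) → Unique xs →
                ¬ (∀ i → Adj G (lookup xs i) (lookup xs (next i)))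
    vec-cycle xs u adj = acyclic (cycle (lookup xs) (λ {i} {j} → lookup-injective u i j) adj)

  no-C₃ : ∀ {a b c} → Adj G a b → Adj G b c → ¬ Adj G c a
  no-C₃ {a} {b} {c} ab bc ca = vec-cycle (a ∷ b ∷ c ∷ [])
    ((adj⇒≢ {G = G} ab ∷ ≢-sym (adj⇒≢ {G = G} ca) ∷ []) ∷ (adj⇒≢ {G = G} bc ∷ []) ∷ [] ∷ [])
    λ { zero → ab ; (suc zero) → bc ; (suc (suc zero)) → ca }

  -- Only the diagonals carry distinctness hypotheses: consecutive vertices differ because they are
  -- adjacent.
  no-C₄ : ∀ {a b c d} → a ≢ c → b ≢ d →
          Adj G a b → Adj G b c → Adj G c d → ¬ Adj G d a
  no-C₄ {a} {b} {c} {d} a≢c b≢d ab bc cd da = vec-cycle (a ∷ b ∷ c ∷ d ∷ [])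
    ( (adj⇒≢ {G = G} ab ∷ a≢c ∷ ≢-sym (adj⇒≢ {G = G} da) ∷ [])
    ∷ (adj⇒≢ {G = G} bc ∷ b≢d ∷ [])
    ∷ (adj⇒≢ {G = G} cd ∷ []) ∷ [] ∷ [])
    λ { zero → ab ; (suc zero) → bc ; (suc (suc zero)) → cd ; (suc (suc (suc zero))) → da }

  no-C₅ : ∀ {a b c d e} → a ≢ c → a ≢ d → b ≢ d → b ≢ e → c ≢ e →
          Adj G a b → Adj G b c → Adj G c d → Adj G d e → ¬ Adj G e a
  no-C₅ {a} {b} {c} {d} {e} a≢c a≢d b≢d b≢e c≢e ab bc cd de ea = vec-cycle (a ∷ b ∷ c ∷ d ∷ e ∷ [])
    ( (adj⇒≢ {G = G} ab ∷ a≢c ∷ a≢d ∷ ≢-sym (adj⇒≢ {G = G} ea) ∷ [])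
    ∷ (adj⇒≢ {G = G} bc ∷ b≢d ∷ b≢e ∷ [])
    ∷ (adj⇒≢ {G = G} cd ∷ c≢e ∷ [])
    ∷ (adj⇒≢ {G = G} de ∷ []) ∷ [] ∷ [])
    λ { zero → ab ; (suc zero) → bc ; (suc (suc zero)) → cd ; (suc (suc (suc zero))) → de
      ; (suc (suc (suc (suc zero)))) → ea }

  -- Acyclicity makes the copy induced: an edge between two leaves on the same side, an edge from a
  -- leaf to the opposite centre, or a leaf shared by both sides closes a triangle, and an edge
  -- between leaves on different sides closes a 4-cycle through `u` and `v`.
  double-star⊑ : ∀ {u v} (a : Fin r → V) (b : Fin s → V) →
                 Injective _≡_ _≡_ a → Injective _≡_ _≡_ b →
                 (∀ i → a i ≢ v) → (∀ j → b j ≢ u) →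
                 Adj G u v → (∀ i → Adj G u (a i)) → (∀ j → Adj G v (b j)) → D r 2 s ⊑ G
  double-star⊑ {r} {s} {u} {v} a b a-inj b-inj a≢v b≢u uv ua vb = record
    { embed     = f
    ; injective = λ {x} {y} → f-inj x y
    ; preserves = λ { (fwd e) → edge e ; (bwd e) → edge e ˢ }
    ; reflects  = λ {x} {y} → f-refl x y
    }
    where
    infix 9 _ˢ
    _ˢ : ∀ {x y} → Adj G x y → Adj G y x
    _ˢ = adj-sym G

    f : DVertex r 2 s → V
    f (path zero)       = u
    f (path (suc zero)) = v
    f (leafˡ i)         = a i
    f (leafʳ j)         = b j

    a≢b : ∀ i j → a i ≢ b j
    a≢b i j e = no-C₃ uv (vb j) (subst (Adj G u) e (ua i) ˢ)

    f-inj : ∀ x y → f x ≡ f y → x ≡ y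
    f-inj (path zero)       (path zero)       e = refl
    f-inj (path zero)       (path (suc zero)) e = contradiction e (adj⇒≢ {G = G} uv)
    f-inj (path zero)       (leafˡ i)         e = contradiction e (adj⇒≢ {G = G} (ua i))
    f-inj (path zero)       (leafʳ j)         e = contradiction (sym e) (b≢u j)
    f-inj (path (suc zero)) (path zero)       e = contradiction (sym e) (adj⇒≢ {G = G} uv)
    f-inj (path (suc zero)) (path (suc zero)) e = refl
    f-inj (path (suc zero)) (leafˡ i)         e = contradiction (sym e) (a≢v i)
    f-inj (path (suc zero)) (leafʳ j)         e = contradiction e (adj⇒≢ {G = G} (vb j))
    f-inj (leafˡ i) (path zero)       e = contradiction (sym e) (adj⇒≢ {G = G} (ua i))
    f-inj (leafˡ i) (path (suc zero)) e = contradiction e (a≢v i)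
    f-inj (leafˡ i) (leafˡ j)         e = cong leafˡ (a-inj e)
    f-inj (leafˡ i) (leafʳ j)         e = contradiction e (a≢b i j)
    f-inj (leafʳ j) (path zero)       e = contradiction e (b≢u j)
    f-inj (leafʳ j) (path (suc zero)) e = contradiction (sym e) (adj⇒≢ {G = G} (vb j))
    f-inj (leafʳ j) (leafˡ i)         e = contradiction (sym e) (a≢b i j)
    f-inj (leafʳ i) (leafʳ j)         e = cong leafʳ (b-inj e)

    edge : ∀ {x y} → DEdge x y → Adj G (f x) (f y)
    edge (path {zero}     {suc zero} _) = uv
    edge (path {suc zero} {zero}     ())
    edge (path {suc zero} {suc zero} ())
    edge (leafˡ {zero} {i} _)     = ua i
    edge (leafʳ {suc zero} {j} _) = vb j

    ¬ab : ∀ i j → ¬ Adj G (a i) (b j)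
    ¬ab i j ab = no-C₄ (≢-sym (b≢u j)) (a≢v i) (ua i) ab (vb j ˢ) (uv ˢ)

    f-refl : ∀ x y → Adj G (f x) (f y) → Adj (D r 2 s) x y
    f-refl (path zero)       (path zero)       e = contradiction e (adj-irrefl G)
    f-refl (path zero)       (path (suc zero)) e = fwd (path refl)
    f-refl (path zero)       (leafˡ i)         e = fwd (leafˡ refl)
    f-refl (path zero)       (leafʳ j)         e = contradiction (e ˢ) (no-C₃ uv (vb j))
    f-refl (path (suc zero)) (path zero)       e = bwd (path refl)
    f-refl (path (suc zero)) (path (suc zero)) e = contradiction e (adj-irrefl G)
    f-refl (path (suc zero)) (leafˡ i)         e = contradiction (e ˢ) (no-C₃ (uv ˢ) (ua i))
    f-refl (path (suc zero)) (leafʳ j)         e = fwd (leafʳ refl)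
    f-refl (leafˡ i) (path zero)       e = bwd (leafˡ refl)
    f-refl (leafˡ i) (path (suc zero)) e = contradiction e (no-C₃ (uv ˢ) (ua i))
    f-refl (leafˡ i) (leafˡ j)         e = contradiction (ua j ˢ) (no-C₃ (ua i) e)
    f-refl (leafˡ i) (leafʳ j)         e = contradiction e (¬ab i j)
    f-refl (leafʳ j) (path zero)       e = contradiction e (no-C₃ uv (vb j))
    f-refl (leafʳ j) (path (suc zero)) e = bwd (leafʳ refl)
    f-refl (leafʳ j) (leafˡ i)         e = contradiction (e ˢ) (¬ab i j)
    f-refl (leafʳ i) (leafʳ j)         e = contradiction (vb j ˢ) (no-C₃ (vb i) e)

2K₂⊑ : (G : Graph V) → ∀ {a b c d} → Adj G a b → Adj G c d →
       ¬ Adj G a c → ¬ Adj G a d → ¬ Adj G b c → ¬ Adj G b d → 2K₂ ⊑ G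
2K₂⊑ {V} G {a} {b} {c} {d} ab cd ¬ac ¬ad ¬bc ¬bd = record
  { embed     = f
  ; injective = λ {x} {y} → f-inj x y
  ; preserves = λ {x} {y} → f-pres x y
  ; reflects  = λ {x} {y} → f-refl x y
  }
  where
  f : Fin 2 ⊎ Fin 2 → V
  f (inj₁ zero)       = a
  f (inj₁ (suc zero)) = b
  f (inj₂ zero)       = c
  f (inj₂ (suc zero)) = d

  ¬cross : ∀ i j → ¬ Adj G (f (inj₁ i)) (f (inj₂ j))
  ¬cross zero       zero       = ¬ac
  ¬cross zero       (suc zero) = ¬ad
  ¬cross (suc zero) zero       = ¬bc
  ¬cross (suc zero) (suc zero) = ¬bd

  mate : ∀ i → ∃ λ j → Adj G (f (inj₁ j)) (f (inj₁ i))
  mate zero       = suc zero , adj-sym G ab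
  mate (suc zero) = zero , ab

  -- If the two edges shared a vertex, the other end of the first edge would be joined to it, which
  -- is one of the excluded cross edges.
  cross≢ : ∀ i j → f (inj₁ i) ≢ f (inj₂ j)
  cross≢ i j e = ¬cross (proj₁ (mate i)) j (subst (Adj G _) e (proj₂ (mate i)))

  f-inj : ∀ x y → f x ≡ f y → x ≡ y
  f-inj (inj₁ zero)       (inj₁ zero)       e = refl
  f-inj (inj₁ zero)       (inj₁ (suc zero)) e = contradiction e (adj⇒≢ {G = G} ab)
  f-inj (inj₁ (suc zero)) (inj₁ zero)       e = contradiction (sym e) (adj⇒≢ {G = G} ab)
  f-inj (inj₁ (suc zero)) (inj₁ (suc zero)) e = refl
  f-inj (inj₁ i)          (inj₂ j)          e = contradiction e (cross≢ i j)
  f-inj (inj₂ i)          (inj₁ j)          e = contradiction (sym e) (cross≢ j i)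
  f-inj (inj₂ zero)       (inj₂ zero)       e = refl
  f-inj (inj₂ zero)       (inj₂ (suc zero)) e = contradiction e (adj⇒≢ {G = G} cd)
  f-inj (inj₂ (suc zero)) (inj₂ zero)       e = contradiction (sym e) (adj⇒≢ {G = G} cd)
  f-inj (inj₂ (suc zero)) (inj₂ (suc zero)) e = refl

  f-pres : ∀ x y → Adj 2K₂ x y → Adj G (f x) (f y)
  f-pres (inj₁ zero)       (inj₁ zero)       (inj₁ e) = contradiction refl e
  f-pres (inj₁ zero)       (inj₁ (suc zero)) _        = ab
  f-pres (inj₁ (suc zero)) (inj₁ zero)       _        = adj-sym G ab
  f-pres (inj₁ (suc zero)) (inj₁ (suc zero)) (inj₁ e) = contradiction refl e
  f-pres (inj₂ zero)       (inj₂ zero)       (inj₂ e) = contradiction refl e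
  f-pres (inj₂ zero)       (inj₂ (suc zero)) _        = cd
  f-pres (inj₂ (suc zero)) (inj₂ zero)       _        = adj-sym G cd
  f-pres (inj₂ (suc zero)) (inj₂ (suc zero)) (inj₂ e) = contradiction refl e

  f-refl : ∀ x y → Adj G (f x) (f y) → Adj 2K₂ x y
  f-refl (inj₁ i) (inj₁ j) e = inj₁ λ { refl → adj-irrefl G e }
  f-refl (inj₁ i) (inj₂ j) e = contradiction e (¬cross i j)
  f-refl (inj₂ i) (inj₁ j) e = contradiction (adj-sym G e) (¬cross j i)
  f-refl (inj₂ i) (inj₂ j) e = inj₂ λ { refl → adj-irrefl G e }

-- Two-element subsets

x∈p─q⇒x∉q : ∀ {x : Fin n} (p q : Subset n) → x ∈ p ─ q → x ∉ q
x∈p─q⇒x∉q (_ ∷ p) (outside ∷ q) here      ()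
x∈p─q⇒x∉q (_ ∷ p) (_ ∷ q)       (there i) (there j) = x∈p─q⇒x∉q p q i j

∣p∣≡0⇒p≡∅ : (p : Subset n) → ∣ p ∣ ≡ 0 → p ≡ ∅
∣p∣≡0⇒p≡∅ []            e = refl
∣p∣≡0⇒p≡∅ (outside ∷ p) e = cong (outside ∷_) (∣p∣≡0⇒p≡∅ p e)

∣p∣≡1⇒p≡⁅x⁆ : (p : Subset n) → ∣ p ∣ ≡ 1 → ∃ λ x → p ≡ ⁅ x ⁆
∣p∣≡1⇒p≡⁅x⁆ (inside  ∷ p) e = zero , cong (inside ∷_) (∣p∣≡0⇒p≡∅ p (ℕ.suc-injective e))
∣p∣≡1⇒p≡⁅x⁆ (outside ∷ p) e =
  let x , eq = ∣p∣≡1⇒p≡⁅x⁆ p e in suc x , cong (outside ∷_) eq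

infix 4 _≡⁅_,_⁆

-- The order of `x` and `y` names a first and a second token. Each pair has both labellings, and
-- `≡⁅⁆-comm` swaps the roles.
record _≡⁅_,_⁆ (p : Subset n) (x y : Fin n) : Set where
  constructor mk
  field
    x≢y : x ≢ y
    eq  : p ≡ ⁅ x ⁆ ∪ ⁅ y ⁆

∣p∣≡2⇒p≡⁅x,y⁆ : (p : Subset n) → ∣ p ∣ ≡ 2 → ∃ λ x → ∃ λ y → p ≡⁅ x , y ⁆
∣p∣≡2⇒p≡⁅x,y⁆ (inside ∷ p) e =
  let y , eq = ∣p∣≡1⇒p≡⁅x⁆ p (ℕ.suc-injective e)
  in zero , suc y , mk (λ ()) (cong (inside ∷_) (trans eq (sym (∪-identityˡ _))))
∣p∣≡2⇒p≡⁅x,y⁆ (outside ∷ p) e =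
  let x , y , mk x≢y eq = ∣p∣≡2⇒p≡⁅x,y⁆ p e
  in suc x , suc y , mk (x≢y ∘ suc-injective) (cong (outside ∷_) eq)

∣⁅x⁆∪⁅y⁆∣≡2 : {x y : Fin n} → x ≢ y → ∣ ⁅ x ⁆ ∪ ⁅ y ⁆ ∣ ≡ 2
∣⁅x⁆∪⁅y⁆∣≡2 {x = zero}  {zero}  x≢y = contradiction refl x≢y
∣⁅x⁆∪⁅y⁆∣≡2 {x = zero}  {suc y} x≢y = cong (1 +_) (trans (cong ∣_∣ (∪-identityˡ ⁅ y ⁆)) (∣⁅x⁆∣≡1 y))
∣⁅x⁆∪⁅y⁆∣≡2 {x = suc x} {zero}  x≢y = cong (1 +_) (trans (cong ∣_∣ (∪-identityʳ ⁅ x ⁆)) (∣⁅x⁆∣≡1 x))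
∣⁅x⁆∪⁅y⁆∣≡2 {x = suc x} {suc y} x≢y = ∣⁅x⁆∪⁅y⁆∣≡2 λ e → x≢y (cong suc e)

module _ {p : Subset n} {x y : Fin n} where

  ≡⁅⁆-comm : p ≡⁅ x , y ⁆ → p ≡⁅ y , x ⁆
  ≡⁅⁆-comm (mk x≢y eq) = mk (≢-sym x≢y) (trans eq (∪-comm ⁅ x ⁆ ⁅ y ⁆))

  ∈⁻ : p ≡⁅ x , y ⁆ → ∀ {z} → z ∈ p → z ≡ x ⊎ z ≡ y
  ∈⁻ (mk _ refl) z∈p with x∈p∪q⁻ ⁅ x ⁆ ⁅ y ⁆ z∈p
  ... | inj₁ i = inj₁ (x∈⁅y⁆⇒x≡y x i)
  ... | inj₂ i = inj₂ (x∈⁅y⁆⇒x≡y y i)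

  ∈ˡ : p ≡⁅ x , y ⁆ → x ∈ p
  ∈ˡ (mk _ refl) = x∈p∪q⁺ (inj₁ (x∈⁅x⁆ x))

  ∈ʳ : p ≡⁅ x , y ⁆ → y ∈ p
  ∈ʳ (mk _ refl) = x∈p∪q⁺ (inj₂ (x∈⁅x⁆ y))

≡⁅⁆-cancelʳ : ∀ {p : Subset n} {x x′ y} → p ≡⁅ x , y ⁆ → p ≡⁅ x′ , y ⁆ → x ≡ x′
≡⁅⁆-cancelʳ P P′ with ∈⁻ P′ (∈ˡ P)
... | inj₁ x≡x′ = x≡x′
... | inj₂ x≡y  = contradiction x≡y (_≡⁅_,_⁆.x≢y P)

≡⁅⁆-unique : ∀ {p q : Subset n} {x y} → p ≡⁅ x , y ⁆ → q ≡⁅ x , y ⁆ → p ≡ q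
≡⁅⁆-unique (mk _ refl) (mk _ refl) = refl

-- Translates a slide from set differences into token moves. The token `y` stays, since otherwise it
-- would lie in `S ─ T` and equal `u`; any other member of `T` is new, hence `v`.
exchange : ∀ {S T : Subset n} {u v y} → S ≡⁅ u , y ⁆ → S ─ T ≡ ⁅ u ⁆ → T ─ S ≡ ⁅ v ⁆ → T ≡⁅ v , y ⁆
exchange {S = S} {T} {u} {v} {y} P S─T T─S = mk (λ { refl → v∉S (∈ʳ P) }) (⊆-antisym to from)
  where
  v∈T─S : v ∈ T ─ S
  v∈T─S = subst (v ∈_) (sym T─S) (x∈⁅x⁆ v)

  v∉S : v ∉ S
  v∉S = x∈p─q⇒x∉q T S v∈T─S

  u∉T : u ∉ T
  u∉T = x∈p─q⇒x∉q S T (subst (u ∈_) (sym S─T) (x∈⁅x⁆ u))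

  to : ∀ {z} → z ∈ T → z ∈ ⁅ v ⁆ ∪ ⁅ y ⁆
  to {z} z∈T with z ∈? S
  ... | no z∉S = x∈p∪q⁺ (inj₁ (subst (z ∈_) T─S (x∈p∧x∉q⇒x∈p─q z∈T z∉S)))
  ... | yes z∈S with ∈⁻ P z∈S
  ...   | inj₁ refl = contradiction z∈T u∉T
  ...   | inj₂ refl = x∈p∪q⁺ (inj₂ (x∈⁅x⁆ y))

  from : ∀ {z} → z ∈ ⁅ v ⁆ ∪ ⁅ y ⁆ → z ∈ T
  from {z} i with x∈p∪q⁻ ⁅ v ⁆ ⁅ y ⁆ i | y ∈? T
  ... | inj₁ z∈v | _ rewrite x∈⁅y⁆⇒x≡y v z∈v = p─q⊆p T S v∈T─S
  ... | inj₂ z∈y | yes y∈T rewrite x∈⁅y⁆⇒x≡y y z∈y = y∈T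
  ... | inj₂ z∈y | no y∉T =
    contradiction (sym (x∈⁅y⁆⇒x≡y u (subst (y ∈_) S─T (x∈p∧x∉q⇒x∈p─q (∈ʳ P) y∉T))))
                  (_≡⁅_,_⁆.x≢y P)

exchange⁻¹ : ∀ {x x′ y : Fin n} → x ≢ x′ → x ≢ y → (⁅ x ⁆ ∪ ⁅ y ⁆) ─ (⁅ x′ ⁆ ∪ ⁅ y ⁆) ≡ ⁅ x ⁆
exchange⁻¹ {x = x} {x′} {y} x≢x′ x≢y = ⊆-antisym to from
  where
  to : ∀ {z} → z ∈ (⁅ x ⁆ ∪ ⁅ y ⁆) ─ (⁅ x′ ⁆ ∪ ⁅ y ⁆) → z ∈ ⁅ x ⁆
  to i with x∈p∪q⁻ ⁅ x ⁆ ⁅ y ⁆ (p─q⊆p _ (⁅ x′ ⁆ ∪ ⁅ y ⁆) i)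
  ... | inj₁ z∈x = z∈x
  ... | inj₂ z∈y = contradiction (x∈p∪q⁺ (inj₂ z∈y)) (x∈p─q⇒x∉q _ (⁅ x′ ⁆ ∪ ⁅ y ⁆) i)

  x∉ : x ∉ ⁅ x′ ⁆ ∪ ⁅ y ⁆
  x∉ i with x∈p∪q⁻ ⁅ x′ ⁆ ⁅ y ⁆ i
  ... | inj₁ j = x≢x′ (x∈⁅y⁆⇒x≡y x′ j)
  ... | inj₂ j = x≢y (x∈⁅y⁆⇒x≡y y j)

  from : ∀ {z} → z ∈ ⁅ x ⁆ → z ∈ (⁅ x ⁆ ∪ ⁅ y ⁆) ─ (⁅ x′ ⁆ ∪ ⁅ y ⁆)
  from i rewrite x∈⁅y⁆⇒x≡y x i = x∈p∧x∉q⇒x∈p─q (x∈p∪q⁺ (inj₁ (x∈⁅x⁆ x))) x∉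

-- Nodes and slides of `TS 2 G`, and its cycles coming from induced subgraphs.

module _ (G : Graph (Fin n)) where

  pair : ∀ {x y} → x ≢ y → ¬ Adj G x y → IndSet 2 G
  pair {x} {y} x≢y ¬xy = ⁅ x ⁆ ∪ ⁅ y ⁆ ⟦,⟧ [ ∣⁅x⁆∪⁅y⁆∣≡2 x≢y , ind ]
    where
    ind : Independent G (⁅ x ⁆ ∪ ⁅ y ⁆)
    ind i j with ∈⁻ (mk x≢y refl) i | ∈⁻ (mk x≢y refl) j
    ... | inj₁ refl | inj₁ refl = adj-irrefl G
    ... | inj₁ refl | inj₂ refl = ¬xy
    ... | inj₂ refl | inj₁ refl = ¬xy ∘ adj-sym G
    ... | inj₂ refl | inj₂ refl = adj-irrefl G

  slideˡ : ∀ {x x′ y} → x ≢ y → x′ ≢ y → Adj G x x′ → Slide G (⁅ x ⁆ ∪ ⁅ y ⁆) (⁅ x′ ⁆ ∪ ⁅ y ⁆)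
  slideˡ {x} {x′} x≢y x′≢y e =
    x , x′ , exchange⁻¹ (adj⇒≢ {G = G} e) x≢y , exchange⁻¹ (≢-sym (adj⇒≢ {G = G} e)) x′≢y , e

  slideʳ : ∀ {x y y′} → x ≢ y → x ≢ y′ → Adj G y y′ → Slide G (⁅ x ⁆ ∪ ⁅ y ⁆) (⁅ x ⁆ ∪ ⁅ y′ ⁆)
  slideʳ {x} {y} {y′} x≢y x≢y′ e = subst₂ (Slide G) (∪-comm ⁅ y ⁆ ⁅ x ⁆) (∪-comm ⁅ y′ ⁆ ⁅ x ⁆)
    (slideˡ (≢-sym x≢y) (≢-sym x≢y′) e)

-- The two tokens P i and Q i stay on different sides of H, so that equality of
-- the unordered pairs is equality of the ordered ones.
TS-cycle : ∀ {m} {H : Graph W} {G : Graph (Fin n)} → H ⊑ G →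
           (P Q : Fin (3 + m) → W) (side : W → Bool) (index : W → W → Fin (3 + m)) →
           (∀ i → side (P i) ≡ true) → (∀ i → side (Q i) ≡ false) →
           (∀ i → index (P i) (Q i) ≡ i) →
           (∀ i → ¬ Adj H (P i) (Q i)) →
           (∀ i → (Adj H (P i) (P (next i)) × Q i ≡ Q (next i))
                ⊎ (P i ≡ P (next i) × Adj H (Q i) (Q (next i)))) →
           Cycle (TS 2 G)
TS-cycle {H = H} {G} H⊑G P Q side index sideP sideQ index-PQ ¬PQ move =
  cycle node node-inj node-adj
  where
  open _⊑_ H⊑G renaming (embed to f)

  fP≢fQ : ∀ i j → f (P i) ≢ f (Q j)
  fP≢fQ i j e = case trans (sym (sideP i)) (trans (cong side (injective e)) (sideQ j)) of λ ()

  node : ∀ i → IndSet 2 G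
  node i = pair G (fP≢fQ i i) (¬PQ i ∘ reflects)

  tokens : ∀ i → value (node i) ≡⁅ f (P i) , f (Q i) ⁆
  tokens i = mk (fP≢fQ i i) refl

  node-inj : Injective _≡_ _≡_ node
  -- `index` recovers `i` from `P i` and `Q i`, so it suffices that equal nodes agree token by
  -- token.
  node-inj {i} {j} e = trans (sym (index-PQ i)) (trans (cong₂ index P≡ Q≡) (index-PQ j))
    where
    P≡ : P i ≡ P j
    P≡ with ∈⁻ (tokens j) (subst (λ N → f (P i) ∈ value N) e (∈ˡ (tokens i)))
    ... | inj₁ p = injective p
    ... | inj₂ q = contradiction q (fP≢fQ i j)

    Q≡ : Q i ≡ Q j
    Q≡ with ∈⁻ (tokens j) (subst (λ N → f (Q i) ∈ value N) e (∈ʳ (tokens i)))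
    ... | inj₁ p = contradiction (sym p) (fP≢fQ j i)
    ... | inj₂ q = injective q

  node-adj : ∀ i → Adj (TS 2 G) (node i) (node (next i))
  node-adj i with move i
  ... | inj₁ (e , q) = subst (λ w → Slide G (value (node i)) (⁅ f (P (next i)) ⁆ ∪ ⁅ f w ⁆)) q
    (slideˡ G (fP≢fQ i i) (fP≢fQ (next i) i) (preserves e))
  ... | inj₂ (p , e) = subst (λ w → Slide G (value (node i)) (⁅ f w ⁆ ∪ ⁅ f (Q (next i)) ⁆)) p
    (slideʳ G (fP≢fQ i i) (fP≢fQ i (next i)) (preserves e))

-- With one token on each edge, the positions form the Cartesian product of two edges, a 4-cycle.
2K₂⊑⇒TS-cycle : {G : Graph (Fin n)} → 2K₂ ⊑ G → Cycle (TS 2 G)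
2K₂⊑⇒TS-cycle 2K₂⊑G = TS-cycle 2K₂⊑G P Q side index
  (from-yes (all? λ i → side (P i) ≟ᵇ true)) (from-yes (all? λ i → side (Q i) ≟ᵇ false))
  (from-yes (all? λ i → index (P i) (Q i) ≟ᶠ i))
  (from-yes (all? λ i → ¬? (adj? 2K₂ (P i) (Q i))))
  λ { zero                   → inj₁ (inj₁ (λ ()) , refl)
    ; (suc zero)             → inj₂ (refl , inj₂ λ ())
    ; (suc (suc zero))       → inj₁ (inj₁ (λ ()) , refl)
    ; (suc (suc (suc zero))) → inj₂ (refl , inj₂ λ ())
    }
  where
  P Q : Fin 4 → Fin 2 ⊎ Fin 2
  P = lookup (inj₁ (# 0) ∷ inj₁ (# 1) ∷ inj₁ (# 1) ∷ inj₁ (# 0) ∷ [])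
  Q = lookup (inj₂ (# 0) ∷ inj₂ (# 0) ∷ inj₂ (# 1) ∷ inj₂ (# 1) ∷ [])

  side : Fin 2 ⊎ Fin 2 → Bool
  side (inj₁ _) = true
  side (inj₂ _) = false

  index : Fin 2 ⊎ Fin 2 → Fin 2 ⊎ Fin 2 → Fin 4
  index (inj₁ zero) (inj₂ zero) = # 0
  index (inj₁ _)    (inj₂ zero) = # 1
  index (inj₁ zero) _           = # 3
  index _           _           = # 2

-- With the tokens on the paths `a₀ u a₁` and `b₀ v b₁`, the positions form a 3 by 3 grid. Only its
-- centre, `u` with `v`, is not independent; the boundary is an 8-cycle.
D₂₂₂⊑⇒TS-cycle : {G : Graph (Fin n)} → D 2 2 2 ⊑ G → Cycle (TS 2 G)
D₂₂₂⊑⇒TS-cycle D⊑G = TS-cycle D⊑G P Q side index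
  (from-yes (all? λ i → side (P i) ≟ᵇ true)) (from-yes (all? λ i → side (Q i) ≟ᵇ false))
  (from-yes (all? λ i → index (P i) (Q i) ≟ᶠ i))
  (from-yes (all? λ i → ¬? (adj? (D 2 2 2) (P i) (Q i))))
  λ { zero                                           → inj₁ (bwd (leafˡ refl) , refl)
    ; (suc zero)                                     → inj₁ (fwd (leafˡ refl) , refl)
    ; (suc (suc zero))                               → inj₂ (refl , bwd (leafʳ refl))
    ; (suc (suc (suc zero)))                         → inj₂ (refl , fwd (leafʳ refl))
    ; (suc (suc (suc (suc zero))))                   → inj₁ (bwd (leafˡ refl) , refl)
    ; (suc (suc (suc (suc (suc zero)))))             → inj₁ (fwd (leafˡ refl) , refl)
    ; (suc (suc (suc (suc (suc (suc zero))))))       → inj₂ (refl , bwd (leafʳ refl))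
    ; (suc (suc (suc (suc (suc (suc (suc zero))))))) → inj₂ (refl , fwd (leafʳ refl))
    }
  where
  u v a₀ a₁ b₀ b₁ : DVertex 2 2 2
  u  = path (# 0)
  v  = path (# 1)
  a₀ = leafˡ (# 0)
  a₁ = leafˡ (# 1)
  b₀ = leafʳ (# 0)
  b₁ = leafʳ (# 1)

  P Q : Fin 8 → DVertex 2 2 2
  P = lookup (a₀ ∷ u  ∷ a₁ ∷ a₁ ∷ a₁ ∷ u  ∷ a₀ ∷ a₀ ∷ [])
  Q = lookup (b₀ ∷ b₀ ∷ b₀ ∷ v  ∷ b₁ ∷ b₁ ∷ b₁ ∷ v  ∷ [])

  side : DVertex 2 2 2 → Bool
  side (path zero)       = true
  side (path (suc zero)) = false
  side (leafˡ _)         = true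
  side (leafʳ _)         = false

  -- Clauses apply in order. The last one serves `a₁` with `b₁` and is a mere default at unvisited
  -- pairs such as `u` with `v`.
  index : DVertex 2 2 2 → DVertex 2 2 2 → Fin 8
  index (leafˡ zero) (leafʳ zero) = # 0
  index (path _)     (leafʳ zero) = # 1
  index (leafˡ _)    (leafʳ zero) = # 2
  index (leafˡ zero) (path _)     = # 7
  index (leafˡ _)    (path _)     = # 3
  index (leafˡ zero) (leafʳ _)    = # 6
  index (path _)     (leafʳ _)    = # 5
  index _            _            = # 4

-- Token walks

module Walk {G : Graph (Fin n)} (acyclic : Acyclic G)
            (2K₂-free : ¬ 2K₂ ⊑ G) (D₂₂₂-free : ¬ D 2 2 2 ⊑ G) (C : Cycle (TS 2 G)) where

  open Cycle C using (m; vertex; distinct)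

  infix 9 _ˢ
  _ˢ : ∀ {x y} → Adj G x y → Adj G y x
  _ˢ = adj-sym G

  S : Fin (3 + m) → Subset n
  S i = value (vertex i)

  At : Fin (3 + m) → Fin n → Fin n → Set
  At i x y = S i ≡⁅ x , y ⁆

  at : ∀ i → ∃ λ x → ∃ λ y → At i x y
  -- The proof part of a node is irrelevant; decidable equality on `ℕ` makes the size equation
  -- usable again.
  at i with _ ⟦,⟧ [ p ] ← vertex i = ∣p∣≡2⇒p≡⁅x,y⁆ _ (recompute (_ ℕ.≟ 2) (proj₁ p))

  independent : ∀ {i x y} → At i x y → ¬ Adj G x y
  independent {i} A xy with _ ⟦,⟧ [ p ] ← vertex i = ⊥-elim-irr (proj₂ p (∈ˡ A) (∈ʳ A) xy)

  At-inj : ∀ {i j x y} → At i x y → At j x y → i ≡ j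
  At-inj A B = distinct (value-injective (≡⁅⁆-unique A B))

  step : ∀ {i x y} → At i x y →
         (∃ λ x′ → Adj G x x′ × At (next i) x′ y) ⊎ (∃ λ y′ → Adj G y y′ × At (next i) x y′)
  step {i} A with u , v , p , q , uv ← next-adj C i
             with ∈⁻ A (p─q⊆p (S i) (S (next i)) (subst (u ∈_) (sym p) (x∈⁅x⁆ u)))
  ... | inj₁ refl = inj₁ (v , uv , exchange A p q)
  ... | inj₂ refl = inj₂ (v , uv , ≡⁅⁆-comm (exchange (≡⁅⁆-comm A) p q))

  -- After a move of the first token, moving it back would revisit a node.
  advance : ∀ {i x x′ y} → At i x y → At (next i) x′ y →
            (∃ λ x″ → x ≢ x″ × Adj G x′ x″ × At (next (next i)) x″ y)
            ⊎ (∃ λ y′ → Adj G y y′ × At (next (next i)) x′ y′)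
  advance A B with step B
  ... | inj₁ (x″ , e , C) = inj₁ (x″ , (λ { refl → next²≢ _ (At-inj C A) }) , e , C)
  ... | inj₂ t            = inj₂ t

  -- Independence of the three nodes excludes three of the four edges between `xx′` and `yy′`.
  -- Without an induced `2K₂` the fourth one must be present.
  turn-adj : ∀ {i x x′ y y′} → At i x y → At (next i) x′ y → At (next (next i)) x′ y′ →
             Adj G x x′ → Adj G y y′ → Adj G x y′
  turn-adj {x = x} {y′ = y′} A B C xx′ yy′ with adj? G x y′
  ... | yes xy′ = xy′
  ... | no ¬xy′ = contradiction
    (2K₂⊑ G xx′ yy′ (independent A) ¬xy′ (independent B) (independent C)) 2K₂-free

  -- The walk is forced to be {u,b} → {a,b} → {a,v} → {a,b′} → {u,b′} → {a′,b′}.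
  no-turn : ∀ {i u a b v} → At i u b → At (next i) a b → At (next (next i)) a v →
            Adj G u a → ¬ Adj G b v
  no-turn {u = u} {a} {b} {v} W₀ W₁ W₂ ua bv =
    -- The last move, from `b` to `v`, was made by the second token, so `advance` is applied with
    -- the roles swapped.
    case advance (≡⁅⁆-comm W₁) (≡⁅⁆-comm W₂) of λ
      { (inj₁ (b′ , b≢b′ , vb′ , W₃)) → second-leaf (≡⁅⁆-comm W₂) W₃ b≢b′ vb′
      -- If the first token moves at once, this second turn yields the edge from `b` to `a′` and
      -- closes the 5-cycle `a u v b a′`.
      ; (inj₂ (a′ , aa′ , W₃)) →
          no-C₅ acyclic (x≢y W₂) (x≢y W₁) (x≢y W₀) (λ { refl → independent W₃ (uv ˢ) }) (x≢y W₃)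
            (ua ˢ) uv (bv ˢ) (turn-adj (≡⁅⁆-comm W₁) (≡⁅⁆-comm W₂) W₃ bv aa′) (aa′ ˢ)
      }
    where
    open _≡⁅_,_⁆

    uv : Adj G u v
    uv = turn-adj W₀ W₁ W₂ ua bv

    leaves : ∀ {i b′} → At i a b′ → At (next i) u b′ → b ≢ b′ → ¬ Adj G v b′
    leaves W₃ W₄ b≢b′ vb′ with advance W₃ W₄
    -- The double star has centres `u` and `v`, with leaves `a`, `a′` at `u` and `b`, `b′` at `v`.
    -- Here `a′` differs from `v` because `a′` and `b′` form a node while `v` and `b′` are adjacent.
    ... | inj₁ (a′ , a≢a′ , ua′ , W₅) = D₂₂₂-free
      (double-star⊑ acyclic (lookup (a ∷ a′ ∷ [])) (lookup (b ∷ _ ∷ []))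
        (λ {i} {j} → lookup-injective ((a≢a′ ∷ []) ∷ [] ∷ []) i j)
        (λ {i} {j} → lookup-injective ((b≢b′ ∷ []) ∷ [] ∷ []) i j)
        (λ { zero → x≢y W₂ ; (suc zero) refl → independent W₅ vb′ })
        (λ { zero → ≢-sym (x≢y W₀) ; (suc zero) → ≢-sym (x≢y W₄) })
        uv
        (λ { zero → ua ; (suc zero) → ua′ })
        (λ { zero → bv ˢ ; (suc zero) → vb′ }))
    -- A turn here would give the edge from `a` to `z`, hence the 5-cycle `a z b′ v u`.
    ... | inj₂ (z , b′z , W₅) =
      no-C₅ acyclic (x≢y W₃) (x≢y W₂) (λ { refl → independent W₅ uv })
        (≢-sym (x≢y W₅)) (≢-sym (x≢y W₄))
        (turn-adj W₃ W₄ W₅ (ua ˢ) b′z) (b′z ˢ) (vb′ ˢ) (uv ˢ) ua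

    second-leaf : ∀ {i b′} → At i v a → At (next i) b′ a → b ≢ b′ → ¬ Adj G v b′
    second-leaf W₂ W₃ b≢b′ vb′ with advance W₂ W₃
    -- If the second token goes on to `b″`, the edges `au` and `b′b″` induce a `2K₂`: a cross edge
    -- at `a` contradicts a node, and one at `u` closes a triangle or a 4-cycle.
    ... | inj₁ (b″ , v≢b″ , b′b″ , W₄) = 2K₂-free
      (2K₂⊑ G (ua ˢ) b′b″ (independent (≡⁅⁆-comm W₃)) (independent (≡⁅⁆-comm W₄))
        (λ ub′ → no-C₃ acyclic uv vb′ (ub′ ˢ))
        (λ ub″ → no-C₄ acyclic (λ { refl → independent W₃ ua }) v≢b″ uv vb′ b′b″ (ub″ ˢ)))
    ... | inj₂ (a′ , aa′ , W₄) with u ≟ᶠ a′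
    ...   | yes refl = leaves (≡⁅⁆-comm W₃) (≡⁅⁆-comm W₄) b≢b′ vb′
    -- The first token can only return to `u`: for any other `a′` the turn gives the edge from `v`
    -- to `a′` and the 4-cycle `u v a′ a`.
    ...   | no u≢a′  = no-C₄ acyclic u≢a′ (x≢y W₂) uv
      (turn-adj W₂ W₃ W₄ vb′ aa′) (aa′ ˢ) (ua ˢ)

  -- Without turns the second token never moves, so the first one runs through a cycle of G.
  first-token-cycle : ∀ {x x′ y} → At zero x y → At (next zero) x′ y → ¬ Adj G x x′
  first-token-cycle {y = y} A B xx′ = acyclic (cycle (proj₁ ∘ moves) moves-inj moves-adj)
    where
    -- The invariant fixes `y` for all positions: the second token rests there and the first one
    -- makes the next move.
    Moves : Fin (3 + m) → Set
    Moves i = ∃ λ x → ∃ λ x′ → At i x y × At (next i) x′ y × Adj G x x′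

    moves-next : ∀ i → Moves i → Moves (next i)
    moves-next i (x , x′ , A , B , xx′) with step B
    ... | inj₁ (x″ , x′x″ , C) = x′ , x″ , B , C , x′x″
    ... | inj₂ (y′ , yy′ , C)  = contradiction yy′ (no-turn A B C xx′)

    moves : ∀ i → Moves i
    moves = <-weakInduction Moves (_ , _ , A , B , xx′)
      (λ i → subst Moves (next-inject₁ i) ∘ moves-next (inject₁ i))

    moves-inj : Injective _≡_ _≡_ (proj₁ ∘ moves)
    moves-inj {i} {j} e with moves i | moves j
    ... | _ , _ , A , _ | _ , _ , B , _ with refl ← e = At-inj A B

    moves-adj : ∀ i → Adj G (proj₁ (moves i)) (proj₁ (moves (next i)))
    moves-adj i with moves i | moves (next i)
    -- The end of move `i` and the start recorded at `next i` are separate witnesses. Both complete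
    -- `y` to the same node, so they agree, also at the wrap-around, where this closes the cycle.
    ... | _ , _ , _ , B , e | _ , _ , B′ , _ = subst (Adj G _) (≡⁅⁆-cancelʳ B B′) e

  no-cycle : ⊥
  no-cycle with x , y , A ← at zero with step A
  ... | inj₁ (x′ , e , B) = first-token-cycle A B e
  ... | inj₂ (y′ , e , B) = first-token-cycle (≡⁅⁆-comm A) (≡⁅⁆-comm B) e

corollary4 : ∀ (n : ℕ) (F : Graph (Fin n)) → Forest F →
    Acyclic (TS 2 F) ⇔ Free ((_ , 2K₂) ∷ (_ , D 2 2 2) ∷ []) F
corollary4 n F forest = mk⇔
  (λ acyclic → (acyclic ∘ 2K₂⊑⇒TS-cycle) List.∷ (acyclic ∘ D₂₂₂⊑⇒TS-cycle) List.∷ List.[])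
  (λ { (2K₂-free List.∷ D-free List.∷ List.[]) C → Walk.no-cycle forest 2K₂-free D-free C })
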